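{- For all integers $k > s \geq 3$, $$\lim_{n \to \infty} \frac{\log f_{s,k}(n)}{\log n} = 2.$$
   Context: A $k$-term arithmetic progression is a set of the form $\{x, x+d, \dots, x+(k-1)d\}$ of integers with common difference $d \neq 0$. A set of integers is $k$-AP free if it contains no such progression. For a finite set $A$ of integers, $f_s(A)$ denotes the number of $s$-term arithmetic progressions contained in $A$. For integers $k > s \geq 3$ and $n \geq 1$, $f_{s,k}(n)$ is the maximum of $f_s(A)$ over all sets $A$ of $n$ nonnegative integers that are $k$-AP free. Logarithms are base $2$. -}

module Defs where

open import Data.Nat using (ℕ; zero; suc; _+_; _*_; _≤_; _<_)
open import Data.Nat.Properties using (_≟_)
open import Data.List using (List; upTo; map; filter; length; cartesianProduct)
open import Data.Nat.ListAction using (sum)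
open import Data.List.Membership.DecPropositional _≟_ using (_∈_; _∈?_)
open import Data.List.Relation.Unary.All using (All; all?)
open import Data.Product using (_×_; _,_; ∃; ∃-syntax; proj₁; proj₂)
open import Relation.Nullary using (¬_)

-- A finite set of nonnegative integers is represented by a duplicate-free
-- list of naturals (see Data.List.Relation.Unary.Unique.Propositional).

-- The s-term AP {x, x+d, ..., x+(s-1)d} (with d ≥ 1) is contained in A.
-- (An AP with d < 0 is the same set as one with -d > 0, so as a set every
--  AP has a unique description with x its least element and d ≥ 1.)
APin : ℕ → List ℕ → ℕ → ℕ → Set
APin s A x d = All (λ i → x + i * d ∈ A) (upTo s)

APfree : ℕ → List ℕ → Set
APfree k A = ¬ (∃[ x ] ∃[ d ] (1 ≤ d × APin k A x d))

-- f_s(A): the number of s-term APs (as sets) contained in A, for s ≥ 2.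
-- Each such AP is counted once via its least element x ∈ A and its
-- difference d ≥ 1; since x, x + d ∈ A we have d ≤ max A ≤ sum A, so
-- ranging d over 1 .. sum A loses nothing.
fAP : ℕ → List ℕ → ℕ
fAP s A = length (filter (λ p → all? (λ i → (proj₁ p + i * proj₂ p) ∈? A) (upTo s))
                         (cartesianProduct A (map suc (upTo (sum A)))))

-- Label the points of Z^D by i ∈ {0, …, s-1} and keep, in layer i, only the points of one sphere
-- |v|² = tᵢ; write a labelled point as the integer with digits i, v₁, …, v_D. A progression with
-- more than s terms cannot change its label, so it would put three collinear points on a sphere.
-- On the other hand, send x, d ∈ {0, …, N-1}^D to the progression whose i-th term is x + i d in
-- layer i. There are only polynomially many (in D) tuples (|x + i d|²)ᵢ, so some tuple t collects
-- N^(2D) / D^O(1) progressions, while there are at most s (s N)^D points. A fixed large N costs an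
-- arbitrarily small exponent as D → ∞. Other values of n are reached by adding points too far away
-- to lie in a long progression. The upper bound holds because two terms determine a progression.
module Submission where

open import Defs
open import Data.Nat using (ℕ; zero; suc; _+_; _*_; _∸_; _^_; _≤_; _<_; z≤n; s≤s; NonZero; _≟_; ⌊_/2⌋; >-nonZero)
open import Data.Nat.Properties
  using (≤-refl; ≤-trans; ≤-reflexive; ≤-total; <⇒≤; <-irrefl; <-cmp; n<1+n; n≤1+n;
         +-identityʳ; +-suc; *-assoc; *-identityˡ; *-identityʳ; *-zeroʳ; *-suc; suc-injective;
         +-cancelˡ-≡; +-cancelʳ-≡; +-mono-≤; +-mono-<-≤; +-monoʳ-≤; +-monoˡ-≤;
         *-mono-≤; *-monoʳ-≤; *-monoˡ-≤; *-cancelʳ-≡; *-cancelʳ-≤;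
         m≤m+n; m≤n+m; m≤m*n; m+[n∸m]≡n; m∸n+n≡m; m+n≡0⇒m≡0; m+n≡0⇒n≡0;
         m<1+n⇒m≤n; ∸-monoʳ-≤; ≮⇒≥; _<?_;
         ^-distribˡ-+-*; ^-*-assoc; ^-monoˡ-≤; ^-monoʳ-≤; m^n>0; m^n≢0;
         ⌊n/2⌋-mono; n≡⌊n+n/2⌋; ⌊n/2⌋+⌈n/2⌉≡n; ⌊n/2⌋≤⌈n/2⌉; module ≤-Reasoning)
open import Data.Nat.DivMod using (_%_; [m+kn]%n≡m%n; m<n⇒m%n≡m)
open import Data.Nat.ListAction using (sum)
open import Data.Nat.Tactic.RingSolver using (solve-∀)
open import Data.Fin using (Fin; toℕ; fromℕ<)
open import Data.Fin.Properties using (toℕ<n; toℕ-fromℕ<; toℕ-injective)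
open import Data.List using (List; []; _∷_; _++_; length; map; filter; upTo; allFin; cartesianProduct;
  cartesianProductWith; deduplicate)
open import Data.List.Properties using (length-map; length-upTo; length-++; length-++-sucʳ; length-tabulate)
open import Data.List.Membership.Propositional using (_∈_)
open import Data.List.Membership.Propositional.Properties
open import Data.List.Relation.Unary.All as All using (All; []; _∷_; all?)
open import Data.List.Relation.Unary.Any using (here; there)
open import Data.List.Relation.Unary.AllPairs using ([]; _∷_)
open import Data.List.Relation.Unary.Unique.Propositional using (Unique)
import Data.List.Relation.Unary.Unique.Propositional.Properties as Unique
open import Data.List.Relation.Unary.Unique.DecPropositional.Properties _≟_ using (deduplicate-!)
open import Data.List.Membership.DecPropositional _≟_ using (_∈?_)
open import Data.Product using (_×_; _,_; proj₁; proj₂; ∃-syntax)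
open import Data.Sum using (inj₁; inj₂)
open import Data.Vec as Vec using (Vec; []; _∷_; lookup; tabulate; zipWith)
open import Data.Vec.Properties using (lookup∘tabulate; ≡-dec; ∷-injective)
open import Data.Vec.Relation.Unary.All as VecAll using ([]; _∷_) renaming (All to AllV)
import Data.Vec.Relation.Unary.All.Properties as VecAll
open import Function using (id)
open import Relation.Binary.Definitions using (DecidableEquality; tri<; tri≈; tri>)
open import Relation.Binary.PropositionalEquality
open import Relation.Nullary using (¬?; Dec; yes; no; contradiction)

-- Counting by injections, products and fibres

-- Deleting one occurrence of `f x` from `ys` keeps the images of all other elements, since these
-- differ from `f x`. Injectivity is asked on `xs` only: digit encodings are injective just on
-- bounded digits.
length-injection : ∀ {X Y : Set} (f : X → Y) {xs : List X} (ys : List Y) → Unique xs →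
  (∀ {x y} → x ∈ xs → y ∈ xs → f x ≡ f y → x ≡ y) →
  (∀ {x} → x ∈ xs → f x ∈ ys) → length xs ≤ length ys
length-injection f {[]} ys uniq inj into = z≤n
length-injection f {x ∷ xs} ys (x∉xs ∷ uniq) inj into with ∈-∃++ (into (here refl))
... | as , bs , refl = begin
  suc (length xs)           ≤⟨ s≤s (length-injection f _ uniq (λ p q → inj (there p) (there q)) into′) ⟩
  suc (length (as ++ bs))   ≡⟨ length-++-sucʳ as (f x) bs ⟨
  length (as ++ f x ∷ bs)   ∎
  where
  open ≤-Reasoning
  into′ : ∀ {y} → y ∈ xs → f y ∈ as ++ bs
  into′ {y} y∈xs with ∈-++⁻ as (into (there y∈xs))
  ... | inj₁ y∈as = ∈-++⁺ˡ y∈as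
  ... | inj₂ (here fy≡fx) = contradiction (inj (here refl) (there y∈xs) (sym fy≡fx)) (All.lookup x∉xs y∈xs)
  ... | inj₂ (there y∈bs) = ∈-++⁺ʳ as y∈bs

length-cartesianProductWith : ∀ {X Y Z : Set} (f : X → Y → Z) xs ys →
  length (cartesianProductWith f xs ys) ≡ length xs * length ys
length-cartesianProductWith f [] ys = refl
length-cartesianProductWith f (x ∷ xs) ys = trans (length-++ (map (f x) ys))
  (cong₂ _+_ (length-map (f x) ys) (length-cartesianProductWith f xs ys))

module _ {X K : Set} (_≟K_ : DecidableEquality K) (key : X → K) where

  fibre : K → List X → List X
  fibre t = filter (λ x → key x ≟K t)

  length-fibre-split : ∀ t (P : List X) →
    length P ≡ length (fibre t P) + length (filter (λ x → ¬? (key x ≟K t)) P)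
  length-fibre-split t [] = refl
  length-fibre-split t (x ∷ P) with key x ≟K t
  ... | yes _ = cong suc (length-fibre-split t P)
  ... | no _ = trans (cong suc (length-fibre-split t P)) (sym (+-suc _ _))

  -- Lets a fibre inside the remainder `R` of `pigeonhole` be bounded by the same fibre in the whole
  -- list.
  fibre-filter : ∀ {Q : X → Set} (Q? : ∀ x → Dec (Q x)) t (P : List X) →
    length (fibre t (filter Q? P)) ≤ length (fibre t P)
  fibre-filter Q? t [] = z≤n
  fibre-filter Q? t (x ∷ P) with Q? x
  fibre-filter Q? t (x ∷ P) | yes _ with key x ≟K t
  ... | yes _ = s≤s (fibre-filter Q? t P)
  ... | no _ = fibre-filter Q? t P
  fibre-filter Q? t (x ∷ P) | no _ with key x ≟K t
  ... | yes _ = ≤-trans (fibre-filter Q? t P) (n≤1+n _)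
  ... | no _ = fibre-filter Q? t P

  -- Split off the fibre of the first key and take a popular key `u` of the rest; the key with the
  -- larger fibre in `P` works.
  pigeonhole : K → ∀ ks (P : List X) → (∀ {x} → x ∈ P → key x ∈ ks) →
    ∃[ t ] length P ≤ length (fibre t P) * length ks
  -- With no keys `P` is empty, and the default `t₀` is returned.
  pigeonhole t₀ [] [] into = t₀ , z≤n
  pigeonhole t₀ [] (x ∷ P) into with () ← into (here refl)
  pigeonhole t₀ (t ∷ ks) P into = choose (≤-total (length (fibre t P)) (length (fibre u P)))
    where
    open ≤-Reasoning
    R = filter (λ x → ¬? (key x ≟K t)) P
    intoR : ∀ {x} → x ∈ R → key x ∈ ks
    intoR x∈R with ∈-filter⁻ (λ x → ¬? (key x ≟K t)) x∈R
    ... | x∈P , kx≢t with into x∈P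
    ...   | here kx≡t = contradiction kx≡t kx≢t
    ...   | there kx∈ks = kx∈ks
    rest = pigeonhole t₀ ks R intoR
    u = proj₁ rest
    bound : ∀ m → length (fibre t P) ≤ m → length (fibre u P) ≤ m → length P ≤ m * suc (length ks)
    bound m t≤m u≤m = begin
      length P                              ≡⟨ length-fibre-split t P ⟩
      length (fibre t P) + length R         ≤⟨ +-mono-≤ t≤m (proj₂ rest) ⟩
      m + length (fibre u R) * length ks    ≤⟨ +-monoʳ-≤ m (*-monoˡ-≤ (length ks) (≤-trans (fibre-filter _ u P) u≤m)) ⟩
      m + m * length ks                     ≡⟨ *-suc m (length ks) ⟨
      m * suc (length ks)                   ∎
    choose : _ → ∃[ t ] length P ≤ length (fibre t P) * suc (length ks)
    choose (inj₁ t≤u) = u , bound _ t≤u ≤-refl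
    choose (inj₂ u≤t) = t , bound _ ≤-refl u≤t

-- Digit vectors

enc : ∀ {D} → ℕ → Vec ℕ D → ℕ
enc b [] = 0
enc b (a ∷ v) = a + enc b v * b

lin : ∀ {D} → Vec ℕ D → ℕ → Vec ℕ D → Vec ℕ D
lin u i v = zipWith (λ a c → a + i * c) u v

norm² : ∀ {D} → Vec ℕ D → ℕ
norm² [] = 0
norm² (a ∷ v) = a * a + norm² v

-- `enc b` evaluates at `b` the polynomial whose coefficients are the digits, so it is linear for
-- digits of any size. Carries matter only for decoding.
enc-lin : ∀ {D} b (u : Vec ℕ D) i v → enc b (lin u i v) ≡ enc b u + i * enc b v
enc-lin b [] i [] = sym (*-zeroʳ i)
enc-lin b (a ∷ u) i (c ∷ v) = trans (cong (λ z → a + i * c + z * b) (enc-lin b u i v))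
  (rearrange a c i b (enc b u) (enc b v))
  where
  rearrange : ∀ a c i b x y → a + i * c + (x + i * y) * b ≡ a + x * b + i * (c + y * b)
  rearrange = solve-∀

-- The remainder modulo `b` recovers the lowest digit; cancel it and divide by `b`.
enc-injective : ∀ {D} b .{{_ : NonZero b}} {u v : Vec ℕ D} →
  AllV (_< b) u → AllV (_< b) v → enc b u ≡ enc b v → u ≡ v
enc-injective b [] [] eq = refl
enc-injective b {a ∷ u} {c ∷ v} (a<b ∷ u<b) (c<b ∷ v<b) eq =
  cong₂ _∷_ a≡c (enc-injective b u<b v<b (*-cancelʳ-≡ _ _ b
    (+-cancelˡ-≡ c _ _ (trans (cong (_+ enc b u * b) (sym a≡c)) eq))))
  where
  open ≡-Reasoning
  a≡c : a ≡ c
  a≡c = begin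
    a                      ≡⟨ m<n⇒m%n≡m a<b ⟨
    a % b                  ≡⟨ [m+kn]%n≡m%n a (enc b u) b ⟨
    (a + enc b u * b) % b  ≡⟨ cong (_% b) eq ⟩
    (c + enc b v * b) % b  ≡⟨ [m+kn]%n≡m%n c (enc b v) b ⟩
    c % b                  ≡⟨ m<n⇒m%n≡m c<b ⟩
    c                      ∎

-- Used with `r = s′` to keep the terms x + i d below `W`, and with `r = s` to keep relations
-- between digits below the base `b`.
lin-bound : ∀ {D N r i} {u v : Vec ℕ D} → i ≤ r →
  AllV (_< N) u → AllV (_< N) v → AllV (_< suc r * N) (lin u i v)
lin-bound i≤r [] [] = []
lin-bound i≤r (a<N ∷ u<N) (c<N ∷ v<N) =
  +-mono-<-≤ a<N (*-mono-≤ i≤r (<⇒≤ c<N)) ∷ lin-bound i≤r u<N v<N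

norm²-bound : ∀ {D N} {v : Vec ℕ D} → AllV (_< N) v → norm² v ≤ D * (N * N)
norm²-bound [] = z≤n
norm²-bound (a<N ∷ v<N) = +-mono-≤ (*-mono-≤ (<⇒≤ a<N) (<⇒≤ a<N)) (norm²-bound v<N)

-- The hypothesis is a + c = 2 b, in the unreduced form in which lin produces it.
square-convex : ∀ a b c → c + 2 * a ≡ a + 2 * b →
  ∃[ e ] (c * c + a * a ≡ 2 * (b * b) + e × (e ≡ 0 → a ≡ b))
square-convex a b c eq with ≤-total a b
... | inj₁ a≤b = 2 * (k * k) , value , λ e≡0 →
  trans (sym (+-identityʳ a)) (trans (cong (a +_) (sym (k≡0 e≡0))) (m+[n∸m]≡n a≤b))
  where
  k = b ∸ a
  k≡0 : 2 * (k * k) ≡ 0 → k ≡ 0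
  k≡0 h with k
  ... | zero = refl
  c≡ : c ≡ a + 2 * k
  c≡ = +-cancelʳ-≡ (2 * a) c (a + 2 * k) (trans eq
    (trans (cong (λ z → a + 2 * z) (sym (m+[n∸m]≡n a≤b))) (lem a k)))
    where
    lem : ∀ a k → a + 2 * (a + k) ≡ a + 2 * k + 2 * a
    lem = solve-∀
  value : c * c + a * a ≡ 2 * (b * b) + 2 * (k * k)
  value = trans (cong (λ z → z * z + a * a) c≡)
    (trans (lem a k) (cong (λ z → 2 * (z * z) + 2 * (k * k)) (m+[n∸m]≡n a≤b)))
    where
    lem : ∀ a k → (a + 2 * k) * (a + 2 * k) + a * a ≡ 2 * ((a + k) * (a + k)) + 2 * (k * k)
    lem = solve-∀
... | inj₂ b≤a = 2 * (k * k) , value , λ e≡0 →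
  trans (sym (m+[n∸m]≡n b≤a)) (trans (cong (b +_) (k≡0 e≡0)) (+-identityʳ b))
  where
  k = a ∸ b
  k≡0 : 2 * (k * k) ≡ 0 → k ≡ 0
  k≡0 h with k
  ... | zero = refl
  -- Now `c` is the smallest of the three, so `b` and `a` are written as `c + k` and `c + k + k`.
  b≡ : c + k ≡ b
  b≡ = +-cancelʳ-≡ (2 * b + k) _ _ (trans (lem₁ c b k)
    (trans (cong (λ z → c + 2 * z) (m+[n∸m]≡n b≤a)) (trans eq
      (trans (cong (_+ 2 * b) (sym (m+[n∸m]≡n b≤a))) (lem₂ b k)))))
    where
    lem₁ : ∀ c b k → c + k + (2 * b + k) ≡ c + 2 * (b + k)
    lem₁ = solve-∀
    lem₂ : ∀ b k → b + k + 2 * b ≡ b + (2 * b + k)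
    lem₂ = solve-∀
  value : c * c + a * a ≡ 2 * (b * b) + 2 * (k * k)
  value = trans (cong (λ z → c * c + z * z) (trans (sym (m+[n∸m]≡n b≤a)) (cong (_+ k) (sym b≡))))
    (trans (lem c k) (cong (λ z → 2 * (z * z) + 2 * (k * k)) b≡))
    where
    lem : ∀ c k → c * c + (c + k + k) * (c + k + k) ≡ 2 * ((c + k) * (c + k)) + 2 * (k * k)
    lem = solve-∀

-- The parallelogram law for the midpoint `v` of `u` and `w`: the defect `e` is 2|u - v|², summed
-- coordinate by coordinate.
norm²-convex : ∀ {D} (u v w : Vec ℕ D) → lin w 2 u ≡ lin u 2 v →
  ∃[ e ] (norm² w + norm² u ≡ 2 * norm² v + e × (e ≡ 0 → u ≡ v))
norm²-convex [] [] [] eq = 0 , refl , λ _ → refl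
norm²-convex (a ∷ u) (b ∷ v) (c ∷ w) eq with ∷-injective eq
... | eq₁ , eq₂ with square-convex a b c eq₁ | norm²-convex u v w eq₂
... | e , val , zer | e′ , val′ , zer′ = e + e′ ,
  trans (lem₁ (c * c) (norm² w) (a * a) (norm² u)) (trans (cong₂ _+_ val val′) (lem₂ (b * b) (norm² v) e e′)) ,
  λ h → cong₂ _∷_ (zer (m+n≡0⇒m≡0 e h)) (zer′ (m+n≡0⇒n≡0 e h))
  where
  lem₁ : ∀ x y z t → x + y + (z + t) ≡ x + z + (y + t)
  lem₁ = solve-∀
  lem₂ : ∀ x y e f → 2 * x + e + (2 * y + f) ≡ 2 * (x + y) + (e + f)
  lem₂ = solve-∀

-- Equal norms turn the parallelogram law into 2t = 2t + e, so the defect vanishes.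
sphere-no-3AP : ∀ {D} {t} (u v w : Vec ℕ D) → lin w 2 u ≡ lin u 2 v →
  norm² u ≡ t → norm² v ≡ t → norm² w ≡ t → u ≡ v
sphere-no-3AP {t = t} u v w eq u≡t v≡t w≡t with norm²-convex u v w eq
... | e , val , zer = zer (sym (+-cancelˡ-≡ (2 * t) 0 e (begin
  2 * t + 0          ≡⟨ lem t ⟩
  t + t              ≡⟨ cong₂ _+_ w≡t u≡t ⟨
  norm² w + norm² u  ≡⟨ val ⟩
  2 * norm² v + e    ≡⟨ cong (λ z → 2 * z + e) v≡t ⟩
  2 * t + e          ∎)))
  where
  open ≡-Reasoning
  lem : ∀ t → 2 * t + 0 ≡ t + t
  lem = solve-∀

-- Boxes of digit vectors

box : ℕ → ∀ D → List (Vec ℕ D)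
box N zero = [] ∷ []
box N (suc D) = cartesianProductWith _∷_ (upTo N) (box N D)

length-box : ∀ N D → length (box N D) ≡ N ^ D
length-box N zero = refl
length-box N (suc D) = trans (length-cartesianProductWith _∷_ (upTo N) (box N D))
  (cong₂ _*_ (length-upTo N) (length-box N D))

box-unique : ∀ N D → Unique (box N D)
box-unique N zero = [] ∷ []
box-unique N (suc D) = Unique.cartesianProductWith⁺ _∷_ ∷-injective (Unique.upTo⁺ N) (box-unique N D)

∈-box⁺ : ∀ {N D} {v : Vec ℕ D} → AllV (_< N) v → v ∈ box N D
∈-box⁺ [] = here refl
∈-box⁺ (a<N ∷ v<N) = ∈-cartesianProductWith⁺ _∷_ (∈-upTo⁺ a<N) (∈-box⁺ v<N)

∈-box⁻ : ∀ {N D} {v : Vec ℕ D} → v ∈ box N D → AllV (_< N) v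
∈-box⁻ {N} {zero} {[]} v∈ = []
∈-box⁻ {N} {suc D} v∈ with ∈-cartesianProductWith⁻ _∷_ (upTo N) (box N D) v∈
... | a , u , a∈ , u∈ , refl = ∈-upTo⁻ a∈ ∷ ∈-box⁻ u∈

-- Arithmetic progressions in lists

∈⇒≤sum : ∀ {a} {A : List ℕ} → a ∈ A → a ≤ sum A
∈⇒≤sum (here refl) = m≤m+n _ _
∈⇒≤sum (there a∈A) = ≤-trans (∈⇒≤sum a∈A) (m≤n+m _ _)

APin⁺ : ∀ {s A x d} → (∀ {i} → i < s → x + i * d ∈ A) → APin s A x d
APin⁺ f = All.tabulate (λ i∈ → f (∈-upTo⁻ i∈))

APin⁻ : ∀ {s A x d} → APin s A x d → ∀ {i} → i < s → x + i * d ∈ A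
APin⁻ ap i<s = All.lookup ap (∈-upTo⁺ i<s)

-- The list whose length is `fAP s A`, named so that progressions can be counted by injections.
aps : ℕ → List ℕ → List (ℕ × ℕ)
aps s A = filter (λ p → all? (λ i → (proj₁ p + i * proj₂ p) ∈? A) (upTo s))
                 (cartesianProduct A (map suc (upTo (sum A))))

∈-aps⁻ : ∀ {s} A {x d} → (x , d) ∈ aps s A → 1 ≤ d × APin s A x d
∈-aps⁻ {s} A p∈ with ∈-filter⁻ (λ p → all? (λ i → (proj₁ p + i * proj₂ p) ∈? A) (upTo s)) p∈
... | p∈× , ap with ∈-cartesianProduct⁻ A (map suc (upTo (sum A))) p∈×
... | x∈A , d∈ with ∈-map⁻ suc d∈
... | _ , _ , refl = s≤s z≤n , ap

-- Since s ≥ 2, both x and x + d lie in `A`, so d ≤ x + d ≤ `sum A` and the search range contains d.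
∈-aps⁺ : ∀ {s A x d} → 2 ≤ s → 1 ≤ d → APin s A x d → (x , d) ∈ aps s A
∈-aps⁺ {s} {A} {x} {suc d} 2≤s _ ap =
  ∈-filter⁺ (λ p → all? (λ i → (proj₁ p + i * proj₂ p) ∈? A) (upTo s))
    (∈-cartesianProduct⁺ (subst (_∈ A) (+-identityʳ x) (APin⁻ ap (<⇒≤ 2≤s))) (∈-map⁺ suc (∈-upTo⁺ d<sum))) ap
  where
  d<sum : suc d ≤ sum A
  d<sum = ≤-trans (≤-trans (m≤n+m (suc d) x) (≤-reflexive (cong (x +_) (sym (*-identityˡ (suc d))))))
    (∈⇒≤sum (APin⁻ ap 2≤s))

aps-unique : ∀ s {A} → Unique A → Unique (aps s A)
aps-unique s {A} uniq = Unique.filter⁺ _ (Unique.cartesianProduct⁺ uniq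
  (Unique.map⁺ suc-injective (Unique.upTo⁺ (sum A))))

-- The first two terms determine the progression.
fAP≤length² : ∀ {s A} → 2 ≤ s → Unique A → fAP s A ≤ length A * length A
fAP≤length² {s} {A} 2≤s uniq = ≤-trans
  (length-injection (λ (x , d) → x + 0 * d , x + 1 * d) (cartesianProduct A A) (aps-unique s uniq) inj into)
  (≤-reflexive (length-cartesianProductWith _,_ A A))
  where
  inj : ∀ {p p′ : ℕ × ℕ} → p ∈ aps s A → p′ ∈ aps s A →
    (proj₁ p + 0 , proj₁ p + 1 * proj₂ p) ≡ (proj₁ p′ + 0 , proj₁ p′ + 1 * proj₂ p′) → p ≡ p′
  inj {x , d} {x′ , d′} _ _ eq with +-cancelʳ-≡ 0 x x′ (cong proj₁ eq)
  ... | refl = cong (x ,_) (trans (sym (*-identityˡ d)) (trans (+-cancelˡ-≡ x _ _ (cong proj₂ eq)) (*-identityˡ d′)))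
  into : ∀ {p} → p ∈ aps s A → (proj₁ p + 0 , proj₁ p + 1 * proj₂ p) ∈ cartesianProduct A A
  into p∈ with ∈-aps⁻ A p∈
  ... | _ , ap = ∈-cartesianProduct⁺ (APin⁻ ap (<⇒≤ 2≤s)) (APin⁻ ap 2≤s)

fAP-mono : ∀ {s A B} → 2 ≤ s → Unique A → (∀ {a} → a ∈ A → a ∈ B) → fAP s A ≤ fAP s B
fAP-mono {s} {A} {B} 2≤s uniq A⊆B = length-injection id (aps s B) (aps-unique s uniq) (λ _ _ eq → eq) into
  where
  into : ∀ {p} → p ∈ aps s A → p ∈ aps s B
  into p∈ with ∈-aps⁻ A p∈
  ... | 1≤d , ap = ∈-aps⁺ 2≤s 1≤d (All.map A⊆B ap)

APfree-mono : ∀ {j k A} → j ≤ k → APfree j A → APfree k A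
APfree-mono j≤k free (x , d , 1≤d , ap) = free (x , d , 1≤d , APin⁺ (λ i<j → APin⁻ ap (≤-trans i<j j≤k)))

-- A term with a successor is smaller than some element, hence is not the maximum `y`. A last term
-- is less than twice its predecessor or equal to it, and the predecessor lies in `A`, so it is at
-- most 2S < `y`. The progression thus avoids `y`.
APfree-far : ∀ {k A} → 3 ≤ k → APfree k A → APfree k (suc (2 * sum A) ∷ A)
APfree-far {k} {A} 3≤k free (x , d , 1≤d , ap) = free (x , d , 1≤d , APin⁺ inA)
  where
  open ≤-Reasoning
  S = sum A
  y = suc (2 * S)
  ≤y : ∀ {z} → z ∈ y ∷ A → z ≤ y
  ≤y (here refl) = ≤-refl
  ≤y (there z∈A) = ≤-trans (∈⇒≤sum z∈A) (≤-trans (m≤m+n S (S + 0)) (n≤1+n _))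
  step : ∀ i → suc (x + i * d) ≤ x + suc i * d
  step i = begin
    suc (x + i * d)    ≤⟨ +-monoˡ-≤ (x + i * d) 1≤d ⟩
    d + (x + i * d)    ≡⟨ lem d x (i * d) ⟩
    x + suc i * d      ∎
    where
    lem : ∀ d x z → d + (x + z) ≡ x + (d + z)
    lem = solve-∀
  nonlast : ∀ {i} → suc i < k → x + i * d ∈ A
  nonlast {i} i+1<k with APin⁻ ap {i} (<⇒≤ i+1<k)
  ... | there z∈A = z∈A
  ... | here z≡y = contradiction
    (≤-trans (s≤s (≤-reflexive (sym z≡y))) (≤-trans (step i) (≤y (APin⁻ ap i+1<k)))) (<-irrefl refl)
  last : ∀ {i} → suc (suc i) < k → x + suc (suc i) * d ≡ y → x + suc (suc i) * d ∈ A
  last {i} i+2<k z≡y = contradiction (begin-strict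
    2 * S                                  <⟨ n<1+n _ ⟩
    y                                      ≡⟨ z≡y ⟨
    x + (d + (d + i * d))                  ≤⟨ m≤m+n _ (x + i * d) ⟩
    x + (d + (d + i * d)) + (x + i * d)    ≡⟨ lem x d (i * d) ⟩
    2 * (x + suc i * d)                    ≤⟨ *-monoʳ-≤ 2 (∈⇒≤sum (nonlast i+2<k)) ⟩
    2 * S                                  ∎) (<-irrefl refl)
    where
    lem : ∀ x d z → x + (d + (d + z)) + (x + z) ≡ 2 * (x + (d + z))
    lem = solve-∀
  inA : ∀ {i} → i < k → x + i * d ∈ A
  -- As k ≥ 3, terms 0 and 1 have successors; any later term has the two predecessors that `last`
  -- uses.
  inA {zero} _ = nonlast (<⇒≤ 3≤k)
  inA {suc zero} _ = nonlast 3≤k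
  inA {suc (suc i)} i<k with APin⁻ ap i<k
  ... | there z∈A = z∈A
  ... | here z≡y = last i<k z≡y

-- Reaches the sizes between those of the construction: each far element is new, creates no k-term
-- progression and destroys no s-term one.
pad : ∀ {s k} → 2 ≤ s → 3 ≤ k → ∀ m A → Unique A → APfree k A →
  ∃[ B ] (Unique B × length B ≡ m + length A × APfree k B × fAP s A ≤ fAP s B)
pad 2≤s 3≤k zero A uniq free = A , uniq , refl , free , ≤-refl
pad {s} 2≤s 3≤k (suc m) A uniq free with pad 2≤s 3≤k m A uniq free
... | B , uniqB , len , freeB , f≤ = suc (2 * sum B) ∷ B , All.tabulate fresh ∷ uniqB , cong suc len ,
  APfree-far 3≤k freeB , ≤-trans f≤ (fAP-mono {s} {B} {suc (2 * sum B) ∷ B} 2≤s uniqB there)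
  where
  fresh : ∀ {b} → b ∈ B → suc (2 * sum B) ≢ b
  fresh b∈B refl = <-irrefl refl (≤-trans (s≤s (m≤m+n (sum B) (sum B + 0))) (∈⇒≤sum b∈B))

-- Layers of spheres

-- An (s+1)-term progression a₀, a₁, …, aₛ does not fit into {0, …, s-1} unless it is constant.
label-constant : ∀ {s a₀ a₁ aₛ} → a₀ < s → aₛ < s → aₛ + s * a₀ ≡ a₀ + s * a₁ → a₀ ≡ a₁
label-constant {s} {a₀} {a₁} {aₛ} a₀<s aₛ<s eq with <-cmp a₀ a₁
... | tri≈ _ a₀≡a₁ _ = a₀≡a₁
... | tri< a₀<a₁ _ _ = contradiction (begin-strict
  a₀ + s * a₁          ≡⟨ eq ⟨
  aₛ + s * a₀          <⟨ +-mono-<-≤ aₛ<s ≤-refl ⟩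
  s + s * a₀           ≡⟨ *-suc s a₀ ⟨
  s * suc a₀           ≤⟨ *-monoʳ-≤ s a₀<a₁ ⟩
  s * a₁               ≤⟨ m≤n+m _ a₀ ⟩
  a₀ + s * a₁          ∎) (<-irrefl refl)
  where open ≤-Reasoning
... | tri> _ _ a₁<a₀ = contradiction (begin-strict
  aₛ + s * a₀          ≡⟨ eq ⟩
  a₀ + s * a₁          <⟨ +-mono-<-≤ a₀<s ≤-refl ⟩
  s + s * a₁           ≡⟨ *-suc s a₁ ⟨
  s * suc a₁           ≤⟨ *-monoʳ-≤ s a₁<a₀ ⟩
  s * a₀               ≤⟨ m≤n+m _ aₛ ⟩
  aₛ + s * a₀          ∎) (<-irrefl refl)
  where open ≤-Reasoning

module Layers (s′ N D : ℕ) (2≤s : 2 ≤ suc s′) (1≤N : 1 ≤ N) where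

  s = suc s′
  -- `W` bounds the coordinates of x + i d for i < s and x, d in the box of side `N`; `C` counts the
  -- candidate values 0, ..., D W² of the squared norm there.
  W = s * N
  C = suc (D * (W * W))
  -- Digits below W are combined with coefficients 1 and at most s; this base avoids carries.
  b = suc s * W

  s≤W : s ≤ W
  s≤W = m≤m*n s N {{>-nonZero 1≤N}}

  W≤b : W ≤ b
  W≤b = m≤m+n W (s * W)

  instance
    b≢0 : NonZero b
    b≢0 = >-nonZero (≤-trans (s≤s z≤n) (≤-trans s≤W W≤b))

  point : Fin s × Vec ℕ D → ℕ
  point (i , v) = enc b (toℕ i ∷ v)

  module _ (t : Vec ℕ s) where

    layered : List (Fin s × Vec ℕ D)
    layered = filter (λ (i , v) → norm² v ≟ lookup t i) (cartesianProduct (allFin s) (box W D))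

    -- Deduplication supplies `Unique` directly; the size is only bounded from above.
    layers : List ℕ
    layers = deduplicate _≟_ (map point layered)

    ∈-layers⁺ : ∀ i {v} → AllV (_< W) v → norm² v ≡ lookup t i → point (i , v) ∈ layers
    ∈-layers⁺ i v<W v≡t = ∈-deduplicate⁺ _≟_ (∈-map⁺ point
      (∈-filter⁺ (λ (i , v) → norm² v ≟ lookup t i) (∈-cartesianProduct⁺ (∈-allFin i) (∈-box⁺ v<W)) v≡t))

    ∈-layers⁻ : ∀ {m} → m ∈ layers → ∃[ i ] ∃[ v ] (AllV (_< W) v × norm² v ≡ lookup t i × m ≡ point (i , v))
    ∈-layers⁻ m∈ with ∈-map⁻ point (∈-deduplicate⁻ _≟_ (map point layered) m∈)
    ... | (i , v) , iv∈ , m≡ with ∈-filter⁻ (λ (i , v) → norm² v ≟ lookup t i) iv∈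
    ... | iv∈× , v≡t with ∈-cartesianProduct⁻ (allFin s) (box W D) iv∈×
    ... | _ , v∈ = i , v , ∈-box⁻ v∈ , v≡t , m≡

    layers-length : length layers ≤ s * W ^ D
    layers-length = begin
      length layers                         ≤⟨ length-injection id _ (deduplicate-! _) (λ _ _ eq → eq) into ⟩
      length (map point candidates)         ≡⟨ length-map point candidates ⟩
      length candidates                     ≡⟨ length-cartesianProductWith _,_ (allFin s) (box W D) ⟩
      length (allFin s) * length (box W D)  ≡⟨ cong₂ _*_ (length-tabulate {n = s} id) (length-box W D) ⟩
      s * W ^ D                             ∎
      where
      open ≤-Reasoning
      candidates = cartesianProduct (allFin s) (box W D)
      into : ∀ {m} → m ∈ layers → m ∈ map point candidates
      into m∈ with ∈-layers⁻ m∈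
      ... | i , v , v<W , _ , refl = ∈-map⁺ point (∈-cartesianProduct⁺ (∈-allFin i) (∈-box⁺ v<W))

    -- Terms 0, 1 and s force a constant label. Terms 0, 1 and 2 then lie on one sphere, so the
    -- first two coincide, against d ≥ 1.
    layers-APfree : APfree (suc s) layers
    layers-APfree (x , d , 1≤d , ap)
      with ∈-layers⁻ (APin⁻ ap {0} (s≤s z≤n)) | ∈-layers⁻ (APin⁻ ap {1} (s≤s (s≤s z≤n)))
         | ∈-layers⁻ (APin⁻ ap {2} (s≤s 2≤s)) | ∈-layers⁻ (APin⁻ ap {s} (n<1+n s))
    ... | i₀ , v₀ , v₀<W , v₀≡t , x₀≡ | i₁ , v₁ , v₁<W , v₁≡t , x₁≡
        | i₂ , v₂ , v₂<W , v₂≡t , x₂≡ | iₛ , vₛ , vₛ<W , vₛ≡t , xₛ≡ = <-irrefl (sym d≡0) 1≤d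
      where
      digits : ∀ {i v} → AllV (_< W) v → AllV (_< W) (toℕ {s} i ∷ v)
      digits {i} v<W = ≤-trans (toℕ<n i) s≤W ∷ v<W
      -- Subtraction-free form of x_j = x_0 + j (x_1 - x_0). Coefficients 1 and j ≤ s keep both
      -- sides within the base, so the relation between integers holds digit by digit.
      affine : ∀ j {i v} → j ≤ s → AllV (_< W) v → x + j * d ≡ point (i , v) →
        lin (toℕ i ∷ v) j (toℕ i₀ ∷ v₀) ≡ lin (toℕ i₀ ∷ v₀) j (toℕ i₁ ∷ v₁)
      affine j {i} {v} j≤s v<W eq = enc-injective b
        (lin-bound j≤s (digits v<W) (digits v₀<W)) (lin-bound j≤s (digits v₀<W) (digits v₁<W)) (begin
          enc b (lin (toℕ i ∷ v) j (toℕ i₀ ∷ v₀))    ≡⟨ enc-lin b (toℕ i ∷ v) j (toℕ i₀ ∷ v₀) ⟩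
          point (i , v) + j * point (i₀ , v₀)        ≡⟨ cong₂ (λ y z → y + j * z) eq x₀≡ ⟨
          x + j * d + j * (x + 0 * d)                ≡⟨ lem x j d ⟩
          x + 0 * d + j * (x + 1 * d)                ≡⟨ cong₂ (λ y z → y + j * z) x₀≡ x₁≡ ⟩
          point (i₀ , v₀) + j * point (i₁ , v₁)      ≡⟨ enc-lin b (toℕ i₀ ∷ v₀) j (toℕ i₁ ∷ v₁) ⟨
          enc b (lin (toℕ i₀ ∷ v₀) j (toℕ i₁ ∷ v₁))  ∎)
        where
        open ≡-Reasoning
        lem : ∀ x j d → x + j * d + j * (x + 0 * d) ≡ x + 0 * d + j * (x + 1 * d)
        lem = solve-∀
      i₀≡i₁ : i₀ ≡ i₁
      i₀≡i₁ = toℕ-injective (label-constant {s} (toℕ<n i₀) (toℕ<n iₛ)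
        (proj₁ (∷-injective (affine s ≤-refl vₛ<W xₛ≡))))
      split₂ = ∷-injective (affine 2 2≤s v₂<W x₂≡)
      i₂≡i₀ : i₂ ≡ i₀
      i₂≡i₀ = toℕ-injective (+-cancelʳ-≡ (2 * toℕ i₀) _ _
        (trans (proj₁ split₂) (cong (λ i → toℕ i₀ + 2 * toℕ i) (sym i₀≡i₁))))
      v₀≡v₁ : v₀ ≡ v₁
      v₀≡v₁ = sphere-no-3AP v₀ v₁ v₂ (proj₂ split₂) v₀≡t
        (trans v₁≡t (cong (lookup t) (sym i₀≡i₁))) (trans v₂≡t (cong (lookup t) i₂≡i₀))
      d≡0 : d ≡ 0
      d≡0 = trans (sym (*-identityˡ d)) (+-cancelˡ-≡ x _ _ (trans x₁≡
        (trans (cong₂ (λ i v → point (i , v)) (sym i₀≡i₁) (sym v₀≡v₁)) (sym x₀≡))))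

  pairs : List (Vec ℕ D × Vec ℕ D)
  pairs = cartesianProduct (box N D) (box N D)

  -- The pigeonhole key: entry i names the sphere that layer i must use to contain the i-th term.
  norms : Vec ℕ D × Vec ℕ D → Vec ℕ s
  norms (x , d) = tabulate (λ i → norm² (lin x (toℕ i) d))

  pairs-bound : ∀ {x d} → (x , d) ∈ pairs → AllV (_< N) x × AllV (_< N) d
  pairs-bound p∈ with ∈-cartesianProduct⁻ (box N D) (box N D) p∈
  ... | x∈ , d∈ = ∈-box⁻ x∈ , ∈-box⁻ d∈

  lin<W : ∀ {x d} → (x , d) ∈ pairs → (i : Fin s) → AllV (_< W) (lin x (toℕ i) d)
  lin<W p∈ i with pairs-bound p∈
  ... | x<N , d<N = lin-bound (m<1+n⇒m≤n (toℕ<n i)) x<N d<N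

  norms-in-box : ∀ {p} → p ∈ pairs → norms p ∈ box C s
  norms-in-box p∈ = ∈-box⁺ (VecAll.tabulate⁺ (λ i → s≤s (norm²-bound (lin<W p∈ i))))

  -- Each pair with key `t` yields a progression whose j-th term is x + j d in layer j, and decoding
  -- start and step recovers the pair.
  fibre≤fAP : ∀ t → length (fibre (≡-dec _≟_) norms t pairs) ≤ fAP s (layers t)
  fibre≤fAP t = length-injection start-step (aps s (layers t))
    (Unique.filter⁺ (λ p → ≡-dec _≟_ (norms p) t) (Unique.cartesianProduct⁺ (box-unique N D) (box-unique N D))) inj into
    where
    -- The leading digits 0 and 1 give term j the label j; the 1 also makes the step positive.
    start-step : Vec ℕ D × Vec ℕ D → ℕ × ℕ
    start-step (x , d) = enc b (0 ∷ x) , enc b (1 ∷ d)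
    F = fibre (≡-dec _≟_) norms t pairs
    unfibre : ∀ {p} → p ∈ F → p ∈ pairs × norms p ≡ t
    unfibre = ∈-filter⁻ (λ p → ≡-dec _≟_ (norms p) t)
    digit : ∀ {a} {v : Vec ℕ D} → a < s → AllV (_< N) v → AllV (_< b) (a ∷ v)
    digit a<s v<N =
      ≤-trans a<s (≤-trans s≤W W≤b) ∷ VecAll.map (λ v<N → ≤-trans v<N (≤-trans (m≤m+n N (s′ * N)) W≤b)) v<N
    inj : ∀ {p p′} → p ∈ F → p′ ∈ F → start-step p ≡ start-step p′ → p ≡ p′
    inj p∈ p′∈ eq with pairs-bound (proj₁ (unfibre p∈)) | pairs-bound (proj₁ (unfibre p′∈))
    ... | x<N , d<N | x′<N , d′<N = cong₂ _,_
      (proj₂ (∷-injective (enc-injective b (digit (s≤s z≤n) x<N) (digit (s≤s z≤n) x′<N) (cong proj₁ eq))))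
      (proj₂ (∷-injective (enc-injective b (digit 2≤s d<N) (digit 2≤s d′<N) (cong proj₂ eq))))
    into : ∀ {p} → p ∈ F → start-step p ∈ aps s (layers t)
    into {x , d} p∈ = ∈-aps⁺ 2≤s (s≤s z≤n) (APin⁺ term)
      where
      term : ∀ {j} → j < s → enc b (0 ∷ x) + j * enc b (1 ∷ d) ∈ layers t
      term {j} j<s = subst (_∈ layers t) eq (∈-layers⁺ t i (lin<W (proj₁ (unfibre p∈)) i)
        (trans (sym (lookup∘tabulate (λ i → norm² (lin x (toℕ i) d)) i)) (cong (λ u → lookup u i) (proj₂ (unfibre p∈)))))
        where
        open ≡-Reasoning
        i = fromℕ< j<s
        eq : point (i , lin x (toℕ i) d) ≡ enc b (0 ∷ x) + j * enc b (1 ∷ d)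
        eq = begin
          enc b (toℕ i ∷ lin x (toℕ i) d)       ≡⟨ cong (λ j → enc b (j ∷ lin x j d)) (toℕ-fromℕ< j<s) ⟩
          enc b (j ∷ lin x j d)                 ≡⟨ cong (λ l → enc b (l ∷ lin x j d)) (*-identityʳ j) ⟨
          enc b (lin (0 ∷ x) j (1 ∷ d))         ≡⟨ enc-lin b (0 ∷ x) j (1 ∷ d) ⟩
          enc b (0 ∷ x) + j * enc b (1 ∷ d)     ∎

  -- The N^(2D) pairs are shared among C^s keys, a number polynomial in D once s and N are fixed.
  many-progressions : ∃[ A ] (Unique A × length A ≤ s * W ^ D × APfree (suc s) A ×
    N ^ D * N ^ D ≤ fAP s A * C ^ s)
  many-progressions
    -- The zero tuple is the default value for `pigeonhole`.
    with pigeonhole (≡-dec _≟_) norms (Vec.replicate s 0) (box C s) pairs norms-in-box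
  ... | t , popular = layers t , deduplicate-! _ , layers-length t , layers-APfree t , (begin
    N ^ D * N ^ D                                             ≡⟨ cong₂ _*_ (length-box N D) (length-box N D) ⟨
    length (box N D) * length (box N D)                       ≡⟨ length-cartesianProductWith _,_ (box N D) (box N D) ⟨
    length pairs                                              ≤⟨ popular ⟩
    length (fibre (≡-dec _≟_) norms t pairs) * length (box C s)
      ≤⟨ *-mono-≤ (fibre≤fAP t) (≤-reflexive (length-box C s)) ⟩
    fAP s (layers t) * C ^ s                  ∎)
    where open ≤-Reasoning

-- Choice of parameters

^-distribʳ-* : ∀ n x y → (x * y) ^ n ≡ x ^ n * y ^ n
^-distribʳ-* zero x y = refl
^-distribʳ-* (suc n) x y = trans (cong (x * y *_) (^-distribʳ-* n x y)) (lem x y (x ^ n) (y ^ n))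
  where
  lem : ∀ x y z t → x * y * (z * t) ≡ x * z * (y * t)
  lem = solve-∀

n<2^n : ∀ n → n < 2 ^ n
n<2^n zero = s≤s z≤n
n<2^n (suc n) = begin
  suc (suc n)     ≤⟨ s≤s (n<2^n n) ⟩
  1 + 2 ^ n       ≤⟨ +-mono-≤ (m^n>0 2 n) (m≤m+n (2 ^ n) 0) ⟩
  2 ^ suc n       ∎
  where open ≤-Reasoning

-- With h about D/2, one factor suc h is at most 2^h, and the remaining power is at most 2^h by
-- induction at h; hence the threshold doubles.
exponential-dominates : ∀ e c → ∃[ D₀ ] (∀ {D} → D₀ ≤ D → c * suc D ^ e ≤ 2 ^ D)
exponential-dominates zero c = c , λ {D} c≤D → begin
  c * 1    ≡⟨ *-identityʳ c ⟩
  c        ≤⟨ c≤D ⟩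
  D        ≤⟨ <⇒≤ (n<2^n D) ⟩
  2 ^ D    ∎
  where open ≤-Reasoning
exponential-dominates (suc e) c with exponential-dominates e (c * 2 ^ suc e)
... | D₀ , small = D₀ + D₀ , λ {D} 2D₀≤D →
  let h = ⌊ D /2⌋
      D≤1+2h : suc D ≤ 2 * suc h
      D≤1+2h = begin
        suc D                      ≡⟨ cong suc (⌊n/2⌋+⌈n/2⌉≡n D) ⟨
        suc (h + ⌊ suc D /2⌋)      ≤⟨ s≤s (+-monoʳ-≤ h (⌊n/2⌋-mono (n≤1+n (suc D)))) ⟩
        suc (h + suc h)            ≡⟨ lem₁ h ⟩
        2 * suc h                  ∎
      D₀≤h : D₀ ≤ h
      D₀≤h = ≤-trans (≤-reflexive (n≡⌊n+n/2⌋ D₀)) (⌊n/2⌋-mono 2D₀≤D)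
  in begin
  c * suc D ^ suc e                            ≤⟨ *-monoʳ-≤ c (^-monoˡ-≤ (suc e) D≤1+2h) ⟩
  c * (2 * suc h) ^ suc e                      ≡⟨ cong (c *_) (^-distribʳ-* (suc e) 2 (suc h)) ⟩
  c * (2 ^ suc e * (suc h * suc h ^ e))        ≡⟨ lem₂ c (2 ^ suc e) (suc h) (suc h ^ e) ⟩
  c * 2 ^ suc e * suc h ^ e * suc h            ≤⟨ *-mono-≤ (small D₀≤h) (n<2^n h) ⟩
  2 ^ h * 2 ^ h                                ≡⟨ ^-distribˡ-+-* 2 h h ⟨
  2 ^ (h + h)                                  ≤⟨ ^-monoʳ-≤ 2 (≤-trans (+-monoʳ-≤ h (⌊n/2⌋≤⌈n/2⌉ D)) (≤-reflexive (⌊n/2⌋+⌈n/2⌉≡n D))) ⟩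
  2 ^ D                                        ∎
  where
  open ≤-Reasoning
  lem₁ : ∀ h → suc (h + suc h) ≡ 2 * suc h
  lem₁ = solve-∀
  lem₂ : ∀ c x y z → c * (x * (y * z)) ≡ c * x * z * y
  lem₂ = solve-∀

-- Fits the shape of `C`, with K = W²: the base is at most (K + 1)(D + 1), and the power of K + 1
-- joins the constant.
exponential-dominates-linear : ∀ K e c → ∃[ D₀ ] (∀ {D} → D₀ ≤ D → c * suc (D * K) ^ e ≤ 2 ^ D)
exponential-dominates-linear K e c with exponential-dominates e (c * suc K ^ e)
... | D₀ , small = D₀ , λ {D} D₀≤D → begin
  c * suc (D * K) ^ e              ≤⟨ *-monoʳ-≤ c (^-monoˡ-≤ e (s≤s (linear K D))) ⟩
  c * (suc K * suc D) ^ e          ≡⟨ cong (c *_) (^-distribʳ-* e (suc K) (suc D)) ⟩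
  c * (suc K ^ e * suc D ^ e)      ≡⟨ *-assoc c _ _ ⟨
  c * suc K ^ e * suc D ^ e        ≤⟨ small D₀≤D ⟩
  2 ^ D                            ∎
  where
  open ≤-Reasoning
  linear : ∀ K D → D * K ≤ D + K * suc D
  linear K D = ≤-trans (m≤n+m (D * K) (K + D)) (≤-reflexive (lem K D))
    where
    lem : ∀ K D → K + D + D * K ≡ D + K * suc D
    lem = solve-∀

-- Walk down from `j + D₀` until `g` no longer exceeds `n`.
bracket : ∀ (g : ℕ → ℕ) j {D₀ n} → g D₀ ≤ n → n < g (j + D₀) →
  ∃[ D ] (D₀ ≤ D × g D ≤ n × n < g (suc D))
bracket g zero g≤n n<g = contradiction (≤-trans n<g g≤n) (<-irrefl refl)
bracket g (suc j) {D₀} {n} g≤n n<g with n <? g (j + D₀)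
... | yes n<g′ = bracket g j g≤n n<g′
... | no n≮g′ = j + D₀ , m≤n+m D₀ j , ≮⇒≥ n≮g′ , n<g

-- This explains the choice N = s^(2q). Then W = s^(2q+1), and with E = 2q - 1 the identity 1 + (2q
-- + 1)(2q - 1) = (2q)² leaves exactly a spare factor s^D.
exponent-balance : ∀ s q E D → suc E ≡ 2 * q →
  s ^ D * ((s * s ^ (2 * q)) ^ D) ^ E ≡ ((s ^ (2 * q)) ^ D * (s ^ (2 * q)) ^ D) ^ q
exponent-balance s q E D 1+E≡2q = begin
  s ^ D * ((s ^ suc (2 * q)) ^ D) ^ E                ≡⟨ cong (λ z → s ^ D * z ^ E) (^-*-assoc s (suc (2 * q)) D) ⟩
  s ^ D * (s ^ (suc (2 * q) * D)) ^ E                ≡⟨ cong (s ^ D *_) (^-*-assoc s (suc (2 * q) * D) E) ⟩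
  s ^ D * s ^ (suc (2 * q) * D * E)                  ≡⟨ ^-distribˡ-+-* s D _ ⟨
  s ^ (D + suc (2 * q) * D * E)                      ≡⟨ cong (λ z → s ^ (D + suc z * D * E)) 1+E≡2q ⟨
  s ^ (D + suc (suc E) * D * E)                      ≡⟨ cong (s ^_) (lem₁ D E) ⟩
  s ^ (suc E * D * suc E)                            ≡⟨ cong (λ z → s ^ (z * D * z)) 1+E≡2q ⟩
  s ^ (2 * q * D * (2 * q))                          ≡⟨ cong (s ^_) (lem₂ D q) ⟩
  s ^ ((2 * q * D + 2 * q * D) * q)                  ≡⟨ ^-*-assoc s (2 * q * D + 2 * q * D) q ⟨
  (s ^ (2 * q * D + 2 * q * D)) ^ q                  ≡⟨ cong (_^ q) (^-distribˡ-+-* s (2 * q * D) (2 * q * D)) ⟩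
  (s ^ (2 * q * D) * s ^ (2 * q * D)) ^ q            ≡⟨ cong (λ z → (z * z) ^ q) (^-*-assoc s (2 * q) D) ⟨
  ((s ^ (2 * q)) ^ D * (s ^ (2 * q)) ^ D) ^ q        ∎
  where
  open ≡-Reasoning
  lem₁ : ∀ D E → D + suc (suc E) * D * E ≡ suc E * D * suc E
  lem₁ = solve-∀
  lem₂ : ∀ D q → 2 * q * D * (2 * q) ≡ (2 * q * D + 2 * q * D) * q
  lem₂ = solve-∀

-- The spare s^D ≥ 2^D absorbs both the constant (sW)^E, lost because `n` may approach the next
-- scale, and M^q, where M is the number of keys.
near-quadratic : ∀ s q E D M n f → 2 ≤ s → suc E ≡ 2 * q → 1 ≤ M →
  let N = s ^ (2 * q) ; W = s * N in
  n ≤ s * W ^ suc D → N ^ D * N ^ D ≤ f * M → (s * W) ^ E * M ^ q ≤ 2 ^ D → n ^ E ≤ f ^ q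
near-quadratic s q E D M n f 2≤s 1+E≡2q 1≤M n≤ pairs≤ small = *-cancelʳ-≤ _ _ (M ^ q) (begin
  n ^ E * M ^ q                              ≤⟨ *-monoˡ-≤ (M ^ q) (^-monoˡ-≤ E n≤) ⟩
  (s * (W * W ^ D)) ^ E * M ^ q              ≡⟨ cong (λ z → z ^ E * M ^ q) (*-assoc s W (W ^ D)) ⟨
  (s * W * W ^ D) ^ E * M ^ q                ≡⟨ cong (_* M ^ q) (^-distribʳ-* E (s * W) (W ^ D)) ⟩
  (s * W) ^ E * (W ^ D) ^ E * M ^ q          ≡⟨ lem ((s * W) ^ E) ((W ^ D) ^ E) (M ^ q) ⟩
  (s * W) ^ E * M ^ q * (W ^ D) ^ E          ≤⟨ *-monoˡ-≤ ((W ^ D) ^ E) (≤-trans small (^-monoˡ-≤ D 2≤s)) ⟩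
  s ^ D * (W ^ D) ^ E                        ≡⟨ exponent-balance s q E D 1+E≡2q ⟩
  (N ^ D * N ^ D) ^ q                        ≤⟨ ^-monoˡ-≤ q pairs≤ ⟩
  (f * M) ^ q                                ≡⟨ ^-distribʳ-* q f M ⟩
  f ^ q * M ^ q                              ∎)
  where
  open ≤-Reasoning
  N = s ^ (2 * q)
  W = s * N
  instance
    M^q≢0 : NonZero (M ^ q)
    M^q≢0 = m^n≢0 M q {{>-nonZero 1≤M}}
  lem : ∀ x y z → x * y * z ≡ x * z * y
  lem = solve-∀

-- For given q the side N stays fixed and only D grows: it is chosen with s W^D ≤ n < s W^(D+1).
lower : ∀ s′ q E → 2 ≤ suc s′ → suc E ≡ 2 * q → ∃[ n₀ ] (1 ≤ n₀ × (∀ {n} → n₀ ≤ n →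
  ∃[ A ] (Unique A × length A ≤ n × APfree (suc (suc s′)) A × n ^ E ≤ fAP (suc s′) A ^ q)))
-- The exponent s q comes from (C^s)^q, the factor (sW)^E from the gap between consecutive scales.
lower s′ q E 2≤s 1+E≡2q with exponential-dominates-linear (W * W) (s * q) ((s * W) ^ E)
  where
  s = suc s′
  W = s * s ^ (2 * q)
... | D₀ , small = scale D₀ , 1≤scale D₀ , build
  where
  s = suc s′
  N = s ^ (2 * q)
  W = s * N
  1≤N : 1 ≤ N
  1≤N = m^n>0 s (2 * q)
  2≤W : 2 ≤ W
  2≤W = ≤-trans 2≤s (m≤m*n s N {{>-nonZero 1≤N}})
  scale : ℕ → ℕ
  scale D = s * W ^ D
  W^D≤scale : ∀ D → W ^ D ≤ scale D
  W^D≤scale D = m≤m+n (W ^ D) (s′ * W ^ D)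
  1≤scale : ∀ D → 1 ≤ scale D
  1≤scale D = ≤-trans (m^n>0 W {{>-nonZero (<⇒≤ 2≤W)}} D) (W^D≤scale D)
  n<scale : ∀ n → n < scale (n + D₀)
  n<scale n = begin-strict
    n                  <⟨ n<2^n n ⟩
    2 ^ n              ≤⟨ ^-monoʳ-≤ 2 (m≤m+n n D₀) ⟩
    2 ^ (n + D₀)       ≤⟨ ^-monoˡ-≤ (n + D₀) 2≤W ⟩
    W ^ (n + D₀)       ≤⟨ W^D≤scale (n + D₀) ⟩
    scale (n + D₀)     ∎
    where open ≤-Reasoning
  build : ∀ {n} → scale D₀ ≤ n →
    ∃[ A ] (Unique A × length A ≤ n × APfree (suc s) A × n ^ E ≤ fAP s A ^ q)
  build {n} n₀≤n with bracket scale n n₀≤n (n<scale n)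
  ... | D , D₀≤D , scale≤n , n<scale′ with Layers.many-progressions s′ N D 2≤s 1≤N
  ... | A , uniq , len , free , many = A , uniq , ≤-trans len scale≤n , free ,
    near-quadratic s q E D (C ^ s) n (fAP s A) 2≤s 1+E≡2q (m^n>0 C s) (<⇒≤ n<scale′) many
      (≤-trans (≤-reflexive (cong ((s * W) ^ E *_) (^-*-assoc C s q))) (small D₀≤D))
    where
    C = suc (D * (W * W))

-- Exact sizes and the limit

exact-size : ∀ {s k e E} q n → 3 ≤ s → s < k → 1 ≤ n → e ≤ E →
  ∃[ A ] (Unique A × length A ≤ n × APfree (suc s) A × n ^ E ≤ fAP s A ^ q) →
  ∃[ B ] (Unique B × length B ≡ n × APfree k B × n ^ e ≤ fAP s B ^ q)
exact-size {s} {k} {e} {E} q n 3≤s s<k 1≤n e≤E (A , uniq , len , free , many)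
  with pad {s} (<⇒≤ 3≤s) (≤-trans 3≤s (<⇒≤ s<k)) (n ∸ length A) A uniq (APfree-mono s<k free)
... | B , uniqB , lenB , freeB , f≤ = B , uniqB , trans lenB (m∸n+n≡m len) , freeB , (begin
  n ^ e                ≤⟨ ^-monoʳ-≤ n {{>-nonZero 1≤n}} e≤E ⟩
  n ^ E                ≤⟨ many ⟩
  fAP s A ^ q          ≤⟨ ^-monoˡ-≤ q f≤ ⟩
  fAP s B ^ q          ∎)
  where open ≤-Reasoning

upper : ∀ {s A} p q → 2 ≤ s → 1 ≤ length A → Unique A → fAP s A ^ q ≤ length A ^ (2 * q + p)
upper {s} {A} p q 2≤s 1≤n uniq = begin
  fAP s A ^ q          ≤⟨ ^-monoˡ-≤ q (fAP≤length² {s} {A} 2≤s uniq) ⟩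
  (n * n) ^ q          ≡⟨ cong (λ z → (n * z) ^ q) (*-identityʳ n) ⟨
  (n ^ 2) ^ q          ≡⟨ ^-*-assoc n 2 q ⟩
  n ^ (2 * q)          ≤⟨ ^-monoʳ-≤ n {{>-nonZero 1≤n}} (m≤m+n (2 * q) p) ⟩
  n ^ (2 * q + p)      ∎
  where
  open ≤-Reasoning
  n = length A

-- With ε = p/q these are the exponentiated forms of 2 - ε ≤ log f / log n ≤ 2 + ε. As f is a
-- maximum, the lower bound needs one set and the upper bound all of them.
theorem1 : (s k : ℕ) → 3 ≤ s → s < k →
    (p q : ℕ) → 1 ≤ p → 1 ≤ q →
    ∃[ N ] ((n : ℕ) → N ≤ n →
    (∃[ A ] (Unique A × length A ≡ n × APfree k A
    × n ^ (2 * q ∸ p) ≤ fAP s A ^ q))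
    × ((A : List ℕ) → Unique A → length A ≡ n → APfree k A →
    fAP s A ^ q ≤ n ^ (2 * q + p)))
theorem1 (suc s′) k 3≤s s<k p q 1≤p 1≤q =
  -- The exponent 2q - 1 is the case p = 1, the strongest one, and covers every p ≥ 1.
  let n₀ , 1≤n₀ , build = lower s′ q (2 * q ∸ 1) (<⇒≤ 3≤s) (m+[n∸m]≡n (≤-trans 1≤q (m≤m+n q (1 * q))))
  in n₀ , λ n n₀≤n → let 1≤n = ≤-trans 1≤n₀ n₀≤n in
    exact-size q n 3≤s s<k 1≤n (∸-monoʳ-≤ (2 * q) 1≤p) (build n₀≤n) ,
    λ { A uniq refl free → upper {suc s′} {A} p q (<⇒≤ 3≤s) 1≤n uniq }
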